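{- Let $p$ and $q$ be distinct primes and let $a,b$ be positive integers. Then \[ B(p^{a}q^{b}) \;\ge\; \min\{p^{a},\,q^{b}\}. \]
   Context: The height $H(f)$ of a polynomial $f\in\mathbb{Z}[x]$ is the maximum of the absolute values of its coefficients. For a positive integer $n$, $B(n)=\max\{H(f): f\in\mathbb{Z}[x],\ f \text{ divides } x^n-1 \text{ in } \mathbb{Z}[x]\}$. -}

module Defs where

open import Data.Nat.Base as ℕ using (ℕ; zero; suc; NonZero; z≤n; s≤s)
import Data.Nat.Properties as ℕₚ
open import Data.Nat.Primality using (Prime; prime⇒nonZero)
open import Data.Integer.Base using (ℤ; +_; 0ℤ; 1ℤ; -1ℤ; _+_; _*_; -_; _-_; _^_; ∣_∣; -[1+_])
import Data.Integer.Properties as ℤₚ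
open import Data.Integer.Tactic.RingSolver using (solve-∀)
open import Data.List.Base
  using (List; []; _∷_; [_]; map; replicate; _++_; length; upTo; applyUpTo; cartesianProductWith; filter)
open import Data.List.Properties using (length-applyUpTo)
open import Data.List.Extrema ℕₚ.≤-totalOrder using (argmax; argmax-sel; f[xs]≤f[argmax])
open import Data.List.Membership.Propositional using (_∈_; find; lose)
open import Data.List.Membership.Propositional.Properties
  using (∈-map⁺; ∈-++⁺ˡ; ∈-++⁺ʳ; ∈-upTo⁺; ∈-cartesianProductWith⁺; ∈-filter⁺; ∈-filter⁻)
open import Data.List.Relation.Unary.Any using (here; there; any?)
import Data.List.Relation.Unary.All as All
open import Data.Product.Base using (∃; _×_; _,_; proj₁; proj₂)
open import Data.Sum.Base using (_⊎_; inj₁; inj₂; [_,_]′)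
open import Data.Empty using (⊥-elim)
open import Relation.Nullary.Decidable.Core using (Dec; yes; no; map′; _×-dec_)
open import Relation.Binary.PropositionalEquality
  using (_≡_; _≢_; refl; sym; trans; cong; cong₂; subst; module ≡-Reasoning)

-- Coefficients in order of increasing degree; trailing zeros are allowed, so
-- equality of polynomials is _≈ᴾ_ and not _≡_.
Poly : Set
Poly = List ℤ

coeff : Poly → ℕ → ℤ
coeff []      _       = 0ℤ
coeff (a ∷ f) zero    = a
coeff (a ∷ f) (suc k) = coeff f k

infix  4 _≈ᴾ_ _∣ᴾ_
infixl 6 _+ᴾ_
infixl 7 _*ᴾ_

_≈ᴾ_ : Poly → Poly → Set
f ≈ᴾ g = ∀ k → coeff f k ≡ coeff g k

_+ᴾ_ : Poly → Poly → Poly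
[]      +ᴾ g       = g
(a ∷ f) +ᴾ []      = a ∷ f
(a ∷ f) +ᴾ (b ∷ g) = (a + b) ∷ (f +ᴾ g)

-- (a + x f) g = a g + x (f g)
_*ᴾ_ : Poly → Poly → Poly
[]      *ᴾ g = []
(a ∷ f) *ᴾ g = map (a *_) g +ᴾ (0ℤ ∷ f *ᴾ g)

X^_ : ℕ → Poly
X^ n = replicate n 0ℤ ++ [ 1ℤ ]

xⁿ-1 : ℕ → Poly
xⁿ-1 n = X^ n +ᴾ [ -1ℤ ]

_∣ᴾ_ : Poly → Poly → Set
f ∣ᴾ h = ∃ λ g → f *ᴾ g ≈ᴾ h

H : Poly → ℕ
H []      = 0
H (a ∷ f) = ∣ a ∣ ℕ.⊔ H f

record IsMaxHeight (n m : ℕ) : Set where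
  field
    attained : ∃ λ f → f ∣ᴾ xⁿ-1 n × H f ≡ m
    bounded  : ∀ f → f ∣ᴾ xⁿ-1 n → H f ℕ.≤ m

module MaxHeightExists where

  coeff-+ : ∀ f g k → coeff (f +ᴾ g) k ≡ coeff f k + coeff g k
  coeff-+ []      g       k       = sym (ℤₚ.+-identityˡ _)
  coeff-+ (a ∷ f) []      k       = sym (ℤₚ.+-identityʳ _)
  coeff-+ (a ∷ f) (b ∷ g) zero    = refl
  coeff-+ (a ∷ f) (b ∷ g) (suc k) = coeff-+ f g k

  coeff-scale : ∀ a g k → coeff (map (a *_) g) k ≡ a * coeff g k
  coeff-scale a []      k       = sym (ℤₚ.*-zeroʳ a)
  coeff-scale a (b ∷ g) zero    = refl
  coeff-scale a (b ∷ g) (suc k) = coeff-scale a g k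

  coeff-*-zero : ∀ a f g → coeff ((a ∷ f) *ᴾ g) 0 ≡ a * coeff g 0
  coeff-*-zero a f g = trans (coeff-+ (map (a *_) g) _ 0)
    (trans (ℤₚ.+-identityʳ _) (coeff-scale a g 0))

  coeff-*-suc : ∀ a f g k →
    coeff ((a ∷ f) *ᴾ g) (suc k) ≡ a * coeff g (suc k) + coeff (f *ᴾ g) k
  coeff-*-suc a f g k = trans (coeff-+ (map (a *_) g) _ (suc k))
    (cong (_+ _) (coeff-scale a g (suc k)))

  *-congʳ : ∀ f {g g′} → g ≈ᴾ g′ → f *ᴾ g ≈ᴾ f *ᴾ g′
  *-congʳ []      e k = refl
  *-congʳ (a ∷ f) {g} {g′} e zero =
    trans (coeff-*-zero a f g) (trans (cong (a *_) (e 0)) (sym (coeff-*-zero a f g′)))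
  *-congʳ (a ∷ f) {g} {g′} e (suc k) =
    trans (coeff-*-suc a f g k)
      (trans (cong₂ (λ u v → a * u + v) (e (suc k)) (*-congʳ f e k)) (sym (coeff-*-suc a f g′ k)))

  zero-* : ∀ f g → f ≈ᴾ [] → f *ᴾ g ≈ᴾ []
  zero-* []      g e k    = refl
  zero-* (a ∷ f) g e zero =
    trans (coeff-*-zero a f g) (trans (cong (_* _) (e 0)) (ℤₚ.*-zeroˡ (coeff g 0)))
  zero-* (a ∷ f) g e (suc k) = trans (coeff-*-suc a f g k)
    (cong₂ _+_ (trans (cong (_* _) (e 0)) (ℤₚ.*-zeroˡ (coeff g (suc k))))
               (zero-* f g (λ j → e (suc j)) k))

  *-zero : ∀ f → f *ᴾ [] ≈ᴾ []
  *-zero []      k       = refl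
  *-zero (a ∷ f) zero    = refl
  *-zero (a ∷ f) (suc k) = *-zero f k

  *-congˡ : ∀ {f f′} g → f ≈ᴾ f′ → f *ᴾ g ≈ᴾ f′ *ᴾ g
  *-congˡ {[]}    {f′}    g e k = sym (zero-* f′ g (λ j → sym (e j)) k)
  *-congˡ {a ∷ f} {[]}    g e k = zero-* (a ∷ f) g e k
  *-congˡ {a ∷ f} {b ∷ f′} g e zero =
    trans (coeff-*-zero a f g) (trans (cong (_* _) (e 0)) (sym (coeff-*-zero b f′ g)))
  *-congˡ {a ∷ f} {b ∷ f′} g e (suc k) =
    trans (coeff-*-suc a f g k)
      (trans (cong₂ (λ u v → u * coeff g (suc k) + v) (e 0) (*-congˡ {f} {f′} g (λ j → e (suc j)) k))
             (sym (coeff-*-suc b f′ g k)))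

  one-* : ∀ g → [ 1ℤ ] *ᴾ g ≈ᴾ g
  one-* g zero = trans (coeff-*-zero 1ℤ [] g) (ℤₚ.*-identityˡ _)
  one-* g (suc k) = trans (coeff-*-suc 1ℤ [] g k) (trans (ℤₚ.+-identityʳ _) (ℤₚ.*-identityˡ _))

  HasDegree : Poly → ℕ → Set
  HasDegree f d = coeff f d ≢ 0ℤ × (∀ k → d ℕ.< k → coeff f k ≡ 0ℤ)

  degree : ∀ f → f ≈ᴾ [] ⊎ ∃ (HasDegree f)
  degree [] = inj₁ λ _ → refl
  degree (a ∷ f) with degree f
  ... | inj₂ (d , ≢0 , above) = inj₂ (suc d , ≢0 , λ { (suc k) (s≤s d<k) → above k d<k })
  ... | inj₁ f≈0 with a ℤₚ.≟ 0ℤ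
  ...   | yes a≡0 = inj₁ λ { zero → a≡0 ; (suc k) → f≈0 k }
  ...   | no  a≢0 = inj₂ (0 , a≢0 , λ { (suc k) _ → f≈0 k })

  coeff-*-top : ∀ f g {d e} → HasDegree f d → HasDegree g e →
    coeff (f *ᴾ g) (d ℕ.+ e) ≡ coeff f d * coeff g e
  coeff-*-top []      g (f≢0 , _) _ = ⊥-elim (f≢0 refl)
  coeff-*-top (a ∷ f) g {zero} {zero} _ _ = coeff-*-zero a f g
  coeff-*-top (a ∷ f) g {zero} {suc e} (_ , above) _ =
    trans (coeff-*-suc a f g e)
      (trans (cong (λ v → a * coeff g (suc e) + v) (zero-* f g (λ k → above (suc k) (s≤s z≤n)) e))
             (ℤₚ.+-identityʳ _))
  coeff-*-top (a ∷ f) g {suc d} {e} (f≢0 , above) dg@(_ , aboveg) =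
    trans (coeff-*-suc a f g (d ℕ.+ e))
      (trans (cong₂ _+_
               (trans (cong (a *_) (aboveg (suc (d ℕ.+ e)) (s≤s (ℕₚ.m≤n+m e d)))) (ℤₚ.*-zeroʳ a))
               (coeff-*-top f g (f≢0 , λ k d<k → above (suc k) (s≤s d<k)) dg))
             (ℤₚ.+-identityˡ _))

  coeff-X^ : ∀ n → coeff (X^ n) n ≡ 1ℤ
  coeff-X^ zero    = refl
  coeff-X^ (suc n) = coeff-X^ n

  coeff-X^-above : ∀ n k → n ℕ.< k → coeff (X^ n) k ≡ 0ℤ
  coeff-X^-above zero    (suc k) _         = refl
  coeff-X^-above (suc n) (suc k) (s≤s n<k) = coeff-X^-above n k n<k

  coeff-X^-1 : ∀ n .{{_ : NonZero n}} → coeff (xⁿ-1 n) n ≡ 1ℤ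
  coeff-X^-1 n@(suc _) = trans (coeff-+ (X^ n) [ -1ℤ ] n) (trans (ℤₚ.+-identityʳ _) (coeff-X^ n))

  coeff-X^-1-above : ∀ n k → n ℕ.< k → coeff (xⁿ-1 n) k ≡ 0ℤ
  coeff-X^-1-above n k@(suc _) n<k =
    trans (coeff-+ (X^ n) [ -1ℤ ] k) (trans (ℤₚ.+-identityʳ _) (coeff-X^-above n k n<k))

  factor-degrees : ∀ n .{{_ : NonZero n}} f g → f *ᴾ g ≈ᴾ xⁿ-1 n →
    (∀ k → n ℕ.< k → coeff f k ≡ 0ℤ) × (∀ k → n ℕ.< k → coeff g k ≡ 0ℤ)
  factor-degrees n f g fg with degree f | degree g
  ... | inj₁ f≈0 | _ with () ← trans (sym (coeff-X^-1 n)) (trans (sym (fg n)) (zero-* f g f≈0 n))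
  ... | inj₂ _ | inj₁ g≈0
    with () ← trans (sym (coeff-X^-1 n)) (trans (sym (fg n)) (trans (*-congʳ f g≈0 n) (*-zero f n)))
  ... | inj₂ (d , df@(f≢0 , fabove)) | inj₂ (e , dg@(g≢0 , gabove)) =
      (λ k n<k → fabove k (ℕₚ.≤-<-trans (ℕₚ.≤-trans (ℕₚ.m≤m+n d e) d+e≤n) n<k))
    , (λ k n<k → gabove k (ℕₚ.≤-<-trans (ℕₚ.≤-trans (ℕₚ.m≤n+m e d) d+e≤n) n<k))
    where
    d+e≤n : d ℕ.+ e ℕ.≤ n
    d+e≤n = ℕₚ.≮⇒≥ λ n<d+e →
      [ f≢0 , g≢0 ]′ (ℤₚ.i*j≡0⇒i≡0∨j≡0 (coeff f d)
        (trans (sym (coeff-*-top f g df dg)) (trans (fg _) (coeff-X^-1-above n _ n<d+e))))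

  eval : Poly → ℤ → ℤ
  eval []      x = 0ℤ
  eval (a ∷ f) x = a + x * eval f x

  eval-zero : ∀ f x → f ≈ᴾ [] → eval f x ≡ 0ℤ
  eval-zero []      x e = refl
  eval-zero (a ∷ f) x e =
    trans (cong₂ (λ u v → u + x * v) (e 0) (eval-zero f x (λ k → e (suc k))))
          (trans (ℤₚ.+-identityˡ _) (ℤₚ.*-zeroʳ x))

  eval-cong : ∀ f g x → f ≈ᴾ g → eval f x ≡ eval g x
  eval-cong []      g       x e = sym (eval-zero g x (λ k → sym (e k)))
  eval-cong (a ∷ f) []      x e = eval-zero (a ∷ f) x e
  eval-cong (a ∷ f) (b ∷ g) x e =
    cong₂ (λ u v → u + x * v) (e 0) (eval-cong f g x (λ k → e (suc k)))

  eval-+ : ∀ f g x → eval (f +ᴾ g) x ≡ eval f x + eval g x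
  eval-+ []      g       x = sym (ℤₚ.+-identityˡ _)
  eval-+ (a ∷ f) []      x = sym (ℤₚ.+-identityʳ _)
  eval-+ (a ∷ f) (b ∷ g) x = trans (cong (λ v → a + b + x * v) (eval-+ f g x))
    (lem a b x (eval f x) (eval g x))
    where
    lem : ∀ a b x u v → a + b + x * (u + v) ≡ (a + x * u) + (b + x * v)
    lem = solve-∀

  eval-scale : ∀ a g x → eval (map (a *_) g) x ≡ a * eval g x
  eval-scale a []      x = sym (ℤₚ.*-zeroʳ a)
  eval-scale a (b ∷ g) x =
    trans (cong (λ v → a * b + x * v) (eval-scale a g x)) (lem a b x (eval g x))
    where
    lem : ∀ a b x u → a * b + x * (a * u) ≡ a * (b + x * u)
    lem = solve-∀

  eval-* : ∀ f g x → eval (f *ᴾ g) x ≡ eval f x * eval g x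
  eval-* []      g x = sym (ℤₚ.*-zeroˡ (eval g x))
  eval-* (a ∷ f) g x = trans (eval-+ (map (a *_) g) (0ℤ ∷ f *ᴾ g) x)
    (trans (cong₂ (λ u v → u + (0ℤ + x * v)) (eval-scale a g x) (eval-* f g x))
           (lem a x (eval f x) (eval g x)))
    where
    lem : ∀ a x u v → a * v + (0ℤ + x * (u * v)) ≡ (a + x * u) * v
    lem = solve-∀

  eval-X^ : ∀ n m → eval (X^ n) (+ m) ≡ + (m ℕ.^ n)
  eval-X^ zero    m = trans (cong (λ v → 1ℤ + v) (ℤₚ.*-zeroʳ (+ m))) refl
  eval-X^ (suc n) m = trans (ℤₚ.+-identityˡ _)
    (trans (cong (λ v → + m * v) (eval-X^ n m)) (sym (ℤₚ.pos-* m (m ℕ.^ n))))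

  eval-X^-1 : ∀ n m → eval (xⁿ-1 n) (+ m) ≡ + (m ℕ.^ n) + -1ℤ
  eval-X^-1 n m = trans (eval-+ (X^ n) [ -1ℤ ] (+ m))
    (cong₂ (λ u v → u + (-1ℤ + v)) (eval-X^ n m) (ℤₚ.*-zeroʳ (+ m)))

  -- Heights of factors of xⁿ - 1 are bounded: a factor takes values dividing
  -- kⁿ - 1 at the points k = 2, …, n + 2, and these bound its coefficients by
  -- repeated division by x - k.

  _÷[x-_] : Poly → ℤ → Poly
  []          ÷[x- c ] = []
  (a ∷ [])    ÷[x- c ] = []
  (a ∷ b ∷ f) ÷[x- c ] = eval (b ∷ f) c ∷ (b ∷ f) ÷[x- c ]

  ÷-eval : ∀ f c x → eval f x ≡ eval f c + (x - c) * eval (f ÷[x- c ]) x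
  ÷-eval []       c x = sym (trans (ℤₚ.+-identityˡ _) (ℤₚ.*-zeroʳ (x - c)))
  ÷-eval (a ∷ []) c x = lem a c x
    where
    lem : ∀ a c x → a + x * 0ℤ ≡ a + c * 0ℤ + (x - c) * 0ℤ
    lem = solve-∀
  ÷-eval (a ∷ f@(_ ∷ _)) c x = trans (cong (λ v → a + x * v) (÷-eval f c x))
    (lem a c x (eval f c) (eval (f ÷[x- c ]) x))
    where
    lem : ∀ a c x r q → a + x * (r + (x - c) * q) ≡ a + c * r + (x - c) * (r + x * q)
    lem = solve-∀

  ÷-length : ∀ f c {d} → length f ℕ.≤ suc d → length (f ÷[x- c ]) ℕ.≤ d
  ÷-length []              c _ = z≤n
  ÷-length (a ∷ [])        c _ = z≤n
  ÷-length (a ∷ f@(_ ∷ _)) c {suc d} (s≤s l) = s≤s (÷-length f c l)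
  ÷-length (a ∷ f@(_ ∷ _)) c {zero} (s≤s ())

  head-bound : ∀ a c r M → ∣ a + c * r ∣ ℕ.≤ M → ∣ r ∣ ℕ.≤ M → ∣ a ∣ ℕ.≤ M ℕ.+ ∣ c ∣ ℕ.* M
  head-bound a c r M h₁ h₂ = begin
    ∣ a ∣                          ≡⟨ cong ∣_∣ (lem a c r) ⟩
    ∣ (a + c * r) - c * r ∣        ≤⟨ ℤₚ.∣i-j∣≤∣i∣+∣j∣ (a + c * r) (c * r) ⟩
    ∣ a + c * r ∣ ℕ.+ ∣ c * r ∣    ≡⟨ cong (∣ a + c * r ∣ ℕ.+_) (ℤₚ.abs-* c r) ⟩
    ∣ a + c * r ∣ ℕ.+ ∣ c ∣ ℕ.* ∣ r ∣ ≤⟨ ℕₚ.+-mono-≤ h₁ (ℕₚ.*-monoʳ-≤ ∣ c ∣ h₂) ⟩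
    M ℕ.+ ∣ c ∣ ℕ.* M              ∎
    where
    open ℕₚ.≤-Reasoning
    lem : ∀ a c r → a ≡ (a + c * r) - c * r
    lem = solve-∀

  ÷-height : ∀ f c M → ∣ eval f c ∣ ℕ.≤ M → H (f ÷[x- c ]) ℕ.≤ M →
    H f ℕ.≤ M ℕ.+ ∣ c ∣ ℕ.* M
  ÷-height []       c M _ _ = z≤n
  ÷-height (a ∷ []) c M h _ = ℕₚ.⊔-lub (head-bound a c 0ℤ M h z≤n) z≤n
  ÷-height (a ∷ f@(_ ∷ _)) c M h₁ h₂ = ℕₚ.⊔-lub
    (head-bound a c (eval f c) M h₁ h₃)
    (÷-height f c M h₃ (ℕₚ.≤-trans (ℕₚ.m≤n⊔m ∣ eval f c ∣ _) h₂))
    where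
    h₃ : ∣ eval f c ∣ ℕ.≤ M
    h₃ = ℕₚ.≤-trans (ℕₚ.m≤m⊔n ∣ eval f c ∣ _) h₂

  interpolationBound : (d c M : ℕ) → ℕ
  interpolationBound zero    c M = 0
  interpolationBound (suc d) c M = N ℕ.+ c ℕ.* N
    where N = M ℕ.⊔ interpolationBound d (suc c) (M ℕ.+ M)

  interpolation : ∀ d c M f → length f ℕ.≤ d →
    (∀ i → i ℕ.< d → ∣ eval f (+ (c ℕ.+ i)) ∣ ℕ.≤ M) → H f ℕ.≤ interpolationBound d c M
  interpolation zero    c M []  _ _ = z≤n
  interpolation (suc d) c M f l h =
    ÷-height f (+ c) _ (ℕₚ.≤-trans hc (ℕₚ.m≤m⊔n M _))
      (ℕₚ.≤-trans (interpolation d (suc c) (M ℕ.+ M) q (÷-length f (+ c) l) hq) (ℕₚ.m≤n⊔m M _))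
    where
    q = f ÷[x- + c ]

    hc : ∣ eval f (+ c) ∣ ℕ.≤ M
    hc = subst (λ k → ∣ eval f (+ k) ∣ ℕ.≤ M) (ℕₚ.+-identityʳ c) (h 0 (s≤s z≤n))

    diff : ∀ i → + suc i * eval q (+ (c ℕ.+ suc i)) ≡ eval f (+ (c ℕ.+ suc i)) - eval f (+ c)
    diff i = sym (trans (cong (_- eval f (+ c)) (÷-eval f (+ c) (+ (c ℕ.+ suc i))))
      (lem (+ c) (+ suc i) (eval f (+ c)) (eval q (+ (c ℕ.+ suc i)))))
      where
      lem : ∀ c s r v → (r + ((c + s) - c) * v) - r ≡ s * v
      lem = solve-∀

    hq′ : ∀ i → i ℕ.< d → ∣ eval q (+ (c ℕ.+ suc i)) ∣ ℕ.≤ M ℕ.+ M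
    hq′ i i<d = begin
      ∣ v ∣                                       ≤⟨ ℕₚ.m≤m+n _ _ ⟩
      suc i ℕ.* ∣ v ∣                             ≡⟨ ℤₚ.abs-* (+ suc i) v ⟨
      ∣ + suc i * v ∣                             ≡⟨ cong ∣_∣ (diff i) ⟩
      ∣ eval f (+ (c ℕ.+ suc i)) - eval f (+ c) ∣ ≤⟨ ℤₚ.∣i-j∣≤∣i∣+∣j∣ (eval f (+ (c ℕ.+ suc i))) _ ⟩
      ∣ eval f (+ (c ℕ.+ suc i)) ∣ ℕ.+ ∣ eval f (+ c) ∣
                                                  ≤⟨ ℕₚ.+-mono-≤ (h (suc i) (s≤s i<d)) hc ⟩
      M ℕ.+ M                                     ∎
      where
      open ℕₚ.≤-Reasoning
      v = eval q (+ (c ℕ.+ suc i))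

    hq : ∀ i → i ℕ.< d → ∣ eval q (+ (suc c ℕ.+ i)) ∣ ℕ.≤ M ℕ.+ M
    hq i i<d = subst (λ k → ∣ eval q (+ k) ∣ ℕ.≤ M ℕ.+ M) (ℕₚ.+-suc c i) (hq′ i i<d)

  ∣m-1∣-bounds : ∀ m → 2 ℕ.≤ m → 1 ℕ.≤ ∣ + m + -1ℤ ∣ × ∣ + m + -1ℤ ∣ ℕ.≤ m
  ∣m-1∣-bounds (suc zero) (s≤s ())
  ∣m-1∣-bounds (suc (suc m)) _ = s≤s z≤n , ℕₚ.n≤1+n _

  2≤^ : ∀ m n .{{_ : NonZero n}} → 2 ℕ.≤ m → 2 ℕ.≤ m ℕ.^ n
  2≤^ m (suc n) 2≤m = ℕₚ.≤-trans 2≤m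
    (ℕₚ.m≤m*n m (m ℕ.^ n) {{ℕₚ.m^n≢0 m n {{ℕ.>-nonZero (ℕₚ.<-trans (s≤s z≤n) 2≤m)}}}})

  factor-value : ∀ n .{{_ : NonZero n}} (u v : ℤ) m → 2 ℕ.≤ m →
    u * v ≡ + (m ℕ.^ n) + -1ℤ → ∣ u ∣ ℕ.≤ m ℕ.^ n
  factor-value n u v m 2≤m uv = go ∣ v ∣ (trans (sym (ℤₚ.abs-* u v)) (cong ∣_∣ uv))
    where
    bs = ∣m-1∣-bounds (m ℕ.^ n) (2≤^ m n 2≤m)
    go : ∀ w → ∣ u ∣ ℕ.* w ≡ ∣ + (m ℕ.^ n) + -1ℤ ∣ → ∣ u ∣ ℕ.≤ m ℕ.^ n
    go zero e with () ← subst (1 ℕ.≤_) (trans (sym e) (ℕₚ.*-zeroʳ ∣ u ∣)) (proj₁ bs)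
    go w@(suc _) e = ℕₚ.≤-trans (ℕₚ.m≤m*n ∣ u ∣ w) (subst (ℕ._≤ m ℕ.^ n) (sym e) (proj₂ bs))

  heightBound : ℕ → ℕ
  heightBound n = interpolationBound (suc n) 2 ((2 ℕ.+ n) ℕ.^ n)

  factor-height : ∀ n .{{_ : NonZero n}} f (g : ℤ → ℤ) → length f ℕ.≤ suc n →
    (∀ m → eval f (+ m) * g (+ m) ≡ + (m ℕ.^ n) + -1ℤ) → H f ℕ.≤ heightBound n
  factor-height n f g l fg = interpolation (suc n) 2 _ f l λ { i (s≤s i≤n) →
    ℕₚ.≤-trans (factor-value n (eval f _) (g _) (2 ℕ.+ i) (s≤s (s≤s z≤n)) (fg (2 ℕ.+ i)))
               (ℕₚ.^-monoˡ-≤ n (ℕₚ.+-monoʳ-≤ 2 i≤n)) }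

  pad : ℕ → Poly → Poly
  pad n f = applyUpTo (coeff f) (suc n)

  coeff-applyUpTo : ∀ (h : ℕ → ℤ) m → (∀ k → m ℕ.≤ k → h k ≡ 0ℤ) →
    ∀ k → coeff (applyUpTo h m) k ≡ h k
  coeff-applyUpTo h zero    z k       = sym (z k z≤n)
  coeff-applyUpTo h (suc m) z zero    = refl
  coeff-applyUpTo h (suc m) z (suc k) =
    coeff-applyUpTo (λ j → h (suc j)) m (λ j m≤j → z (suc j) (s≤s m≤j)) k

  H-≥ : ∀ f k → ∣ coeff f k ∣ ℕ.≤ H f
  H-≥ []      k       = z≤n
  H-≥ (a ∷ f) zero    = ℕₚ.m≤m⊔n _ _
  H-≥ (a ∷ f) (suc k) = ℕₚ.≤-trans (H-≥ f k) (ℕₚ.m≤n⊔m ∣ a ∣ _)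

  H-lub : ∀ f M → (∀ k → ∣ coeff f k ∣ ℕ.≤ M) → H f ℕ.≤ M
  H-lub []      M h = z≤n
  H-lub (a ∷ f) M h = ℕₚ.⊔-lub (h 0) (H-lub f M (λ k → h (suc k)))

  H-mono : ∀ {f g} → f ≈ᴾ g → H f ℕ.≤ H g
  H-mono {f} {g} e = H-lub f (H g) λ k → subst (λ c → ∣ c ∣ ℕ.≤ H g) (sym (e k)) (H-≥ g k)

  interval : ℕ → List ℤ
  interval b = map +_ (upTo (suc b)) ++ map (λ i → - (+ i)) (upTo (suc b))

  ∈-interval : ∀ b i → ∣ i ∣ ℕ.≤ b → i ∈ interval b
  ∈-interval b (+ m)    h = ∈-++⁺ˡ (∈-map⁺ +_ (∈-upTo⁺ (s≤s h)))
  ∈-interval b -[1+ m ] h =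
    ∈-++⁺ʳ (map +_ (upTo (suc b))) (∈-map⁺ (λ i → - (+ i)) (∈-upTo⁺ (s≤s h)))

  box : (b l : ℕ) → List Poly
  box b zero    = [ [] ]
  box b (suc l) = cartesianProductWith _∷_ (interval b) (box b l)

  ∈-box : ∀ b f → H f ℕ.≤ b → f ∈ box b (length f)
  ∈-box b []      h = here refl
  ∈-box b (a ∷ f) h = ∈-cartesianProductWith⁺ _∷_
    (∈-interval b a (ℕₚ.≤-trans (ℕₚ.m≤m⊔n _ _) h))
    (∈-box b f (ℕₚ.≤-trans (ℕₚ.m≤n⊔m ∣ a ∣ _) h))

  candidates : ℕ → List Poly
  candidates n = box (heightBound n) (suc n)

  ≈-dec : ∀ f g → Dec (f ≈ᴾ g)
  ≈-dec []      []      = yes λ _ → refl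
  ≈-dec []      (b ∷ g) = map′ (λ { (e , es) zero → e ; (e , es) (suc k) → es k })
    (λ e → e 0 , λ k → e (suc k)) ((0ℤ ℤₚ.≟ b) ×-dec ≈-dec [] g)
  ≈-dec (a ∷ f) []      = map′ (λ { (e , es) zero → e ; (e , es) (suc k) → es k })
    (λ e → e 0 , λ k → e (suc k)) ((a ℤₚ.≟ 0ℤ) ×-dec ≈-dec f [])
  ≈-dec (a ∷ f) (b ∷ g) = map′ (λ { (e , es) zero → e ; (e , es) (suc k) → es k })
    (λ e → e 0 , λ k → e (suc k)) ((a ℤₚ.≟ b) ×-dec ≈-dec f g)

  module Divisors (n : ℕ) .{{_ : NonZero n}} where

    module _ (f g : Poly) (fg : f *ᴾ g ≈ᴾ xⁿ-1 n) where

      pad-f : pad n f ≈ᴾ f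
      pad-f = coeff-applyUpTo (coeff f) (suc n) (proj₁ (factor-degrees n f g fg))

      pad-g : pad n g ≈ᴾ g
      pad-g = coeff-applyUpTo (coeff g) (suc n) (proj₂ (factor-degrees n f g fg))

      pad-* : pad n f *ᴾ pad n g ≈ᴾ xⁿ-1 n
      pad-* k = trans (*-congˡ {pad n f} {f} (pad n g) pad-f k) (trans (*-congʳ f pad-g k) (fg k))

      values : ∀ m → eval (pad n f) (+ m) * eval (pad n g) (+ m) ≡ + (m ℕ.^ n) + -1ℤ
      values m = trans (sym (eval-* (pad n f) (pad n g) (+ m)))
        (trans (eval-cong (pad n f *ᴾ pad n g) (xⁿ-1 n) (+ m) pad-*) (eval-X^-1 n m))

      length-pad : ∀ h → length (pad n h) ≡ suc n
      length-pad h = length-applyUpTo (coeff h) (suc n)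

      candidate-f : pad n f ∈ candidates n
      candidate-f = subst (λ l → pad n f ∈ box (heightBound n) l) (length-pad f)
        (∈-box _ (pad n f) (factor-height n (pad n f) (eval (pad n g))
          (ℕₚ.≤-reflexive (length-pad f)) values))

      candidate-g : pad n g ∈ candidates n
      candidate-g = subst (λ l → pad n g ∈ box (heightBound n) l) (length-pad g)
        (∈-box _ (pad n g) (factor-height n (pad n g) (eval (pad n f))
          (ℕₚ.≤-reflexive (length-pad g))
          (λ m → trans (ℤₚ.*-comm (eval (pad n g) (+ m)) _) (values m))))

    ∣-dec : ∀ f → Dec (f ∣ᴾ xⁿ-1 n)
    ∣-dec f = map′
      (λ found → proj₁ (find found) , proj₂ (proj₂ (find found)))
      (λ { (g , fg) → lose (candidate-g f g fg)
             (λ k → trans (*-congʳ f (pad-g f g fg) k) (fg k)) })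
      (any? (λ g → ≈-dec (f *ᴾ g) (xⁿ-1 n)) (candidates n))

    divisors : List Poly
    divisors = filter ∣-dec (candidates n)

    tallest : Poly
    tallest = argmax H [ 1ℤ ] divisors

    tallest-∣ : tallest ∣ᴾ xⁿ-1 n
    tallest-∣ with argmax-sel H [ 1ℤ ] divisors
    ... | inj₁ e   = subst (_∣ᴾ xⁿ-1 n) (sym e) (xⁿ-1 n , one-* (xⁿ-1 n))
    ... | inj₂ mem = proj₂ (∈-filter⁻ ∣-dec {xs = candidates n} mem)

    tallest-max : ∀ f → f ∣ᴾ xⁿ-1 n → H f ℕ.≤ H tallest
    tallest-max f (g , fg) = ℕₚ.≤-trans (H-mono {f} {pad n f} (λ k → sym (pad-f f g fg k)))
      (All.lookup (f[xs]≤f[argmax] {f = H} [ 1ℤ ] divisors)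
        (∈-filter⁺ ∣-dec (candidate-f f g fg) (pad n g , pad-* f g fg)))

abstract
  maxHeight-exists : ∀ n .{{_ : NonZero n}} → ∃ (IsMaxHeight n)
  maxHeight-exists n = H tallest , record
    { attained = tallest , tallest-∣ , refl
    ; bounded  = tallest-max
    }
    where open MaxHeightExists.Divisors n

-- For n = 0 every polynomial divides xⁿ - 1 = 0 and there is no maximum.
B : (n : ℕ) .{{_ : NonZero n}} → ℕ
B n = proj₁ (maxHeight-exists n)

-- B does not compute (maxHeight-exists is abstract); this determines it uniquely.
B-isMaxHeight : ∀ n .{{_ : NonZero n}} → IsMaxHeight n (B n)
B-isMaxHeight n = proj₂ (maxHeight-exists n)

p^a*q^b≢0 : ∀ {p q} → Prime p → Prime q → ∀ a b → NonZero (p ℕ.^ a ℕ.* q ℕ.^ b)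
p^a*q^b≢0 {p} {q} pp pq a b = ℕₚ.m*n≢0 (p ℕ.^ a) (q ℕ.^ b)
  where instance
    _ = ℕₚ.m^n≢0 p a {{prime⇒nonZero pp}}
    _ = ℕₚ.m^n≢0 q b {{prime⇒nonZero pq}}

{-# OPTIONS --safe #-}
-- Write P = pᵃ, Q = qᵇ and [n] = 1 + x + … + xⁿ⁻¹. The product [P] [Q] has
-- coefficient min(P, Q) at degree min(P, Q) - 1. As P and Q are coprime, Bézout
-- gives 1 + y Q = x P (or the reverse) in ℕ, so [x P] = 1 + x [y Q] is a
-- combination u [P] + v [Q] = 1 in ℤ[x]. Since [P] and [Q] both divide [P Q], so
-- does their product, and [P Q] divides x^(P Q) - 1.
--
-- A polynomial over ℤ is determined by its values at the naturals, so all
-- polynomial identities are checked as identities between integer values.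
module Submission where

open import Defs
open import Data.Nat using (ℕ; _*_; _^_; _≤_; _<_; _⊓_)
open import Data.Nat.Primality using (Prime)
open import Relation.Binary.PropositionalEquality using (_≢_)

open MaxHeightExists
open import Data.Nat.Base using (zero; suc; s≤s; z≤n; NonZero)
import Data.Nat.Base as ℕ
import Data.Nat.Properties as ℕₚ
open import Data.Nat.Coprimality as Coprimality
  using (Coprime; 1-coprimeTo; coprime-divisor; coprime-Bézout)
open import Data.Nat.Divisibility using (∣-trans)
open import Data.Nat.GCD using (module Bézout)
open import Data.Nat.Primality using (prime⇒irreducible)
open import Data.Integer.Base as ℤ using (+_; 0ℤ; 1ℤ; -1ℤ; ∣_∣)
import Data.Integer.Properties as ℤₚ
open import Data.Integer.Tactic.RingSolver using (solve-∀)
open import Data.List.Base using ([]; _∷_; [_]; length; map; replicate)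
open import Data.Product.Base using (∃₂; _,_)
open import Data.Sum.Base using (inj₁; inj₂)
open import Relation.Nullary.Negation using (contradiction)
open import Relation.Binary.PropositionalEquality
  using (_≡_; refl; sym; trans; cong; cong₂; subst; module ≡-Reasoning)

interpolationBound-0 : ∀ d c → interpolationBound d c 0 ≡ 0
interpolationBound-0 zero    c = refl
interpolationBound-0 (suc d) c rewrite interpolationBound-0 d (suc c) = ℕₚ.*-zeroʳ c

-- `interpolation` bounds the height by the sizes of the values at `0, …, length f - 1`. When these
-- are all 0, the bound itself collapses to 0.
vanishing⇒≈0 : ∀ f → (∀ m → eval f (+ m) ≡ 0ℤ) → f ≈ᴾ []
vanishing⇒≈0 f vanish k = ℤₚ.∣i∣≡0⇒i≡0 (ℕₚ.n≤0⇒n≡0 (ℕₚ.≤-trans (H-≥ f k) H≤0))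
  where
  H≤0 : H f ≤ 0
  H≤0 = subst (H f ≤_) (interpolationBound-0 (length f) 0)
    (interpolation (length f) 0 0 f ℕₚ.≤-refl
      (λ m _ → ℕₚ.≤-reflexive (cong ∣_∣ (vanish m))))

eval-injective : ∀ f g → (∀ m → eval f (+ m) ≡ eval g (+ m)) → f ≈ᴾ g
eval-injective f g f≗g k = ℤₚ.i-j≡0⇒i≡j (coeff f k) (coeff g k) (begin
  coeff f k ℤ.- coeff g k                        ≡⟨ cong (λ i → coeff f k ℤ.+ i) (ℤₚ.-1*i≡-i (coeff g k)) ⟨
  coeff f k ℤ.+ -1ℤ ℤ.* coeff g k                ≡⟨ cong (λ i → coeff f k ℤ.+ i) (coeff-scale -1ℤ g k) ⟨
  coeff f k ℤ.+ coeff (map (-1ℤ ℤ.*_) g) k       ≡⟨ coeff-+ f _ k ⟨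
  coeff f-g k                                    ≡⟨ vanishing⇒≈0 f-g vanish k ⟩
  0ℤ                                             ∎)
  where
  open ≡-Reasoning
  -- The difference is formed by scaling `g` by -1, so that `coeff-scale` and `eval-scale` apply.
  f-g = f +ᴾ map (-1ℤ ℤ.*_) g

  vanish : ∀ m → eval f-g (+ m) ≡ 0ℤ
  vanish m = begin
    eval f-g (+ m)                           ≡⟨ eval-+ f _ (+ m) ⟩
    eval f (+ m) ℤ.+ eval (map (-1ℤ ℤ.*_) g) (+ m) ≡⟨ cong₂ ℤ._+_ (f≗g m) (eval-scale -1ℤ g (+ m)) ⟩
    eval g (+ m) ℤ.+ -1ℤ ℤ.* eval g (+ m)    ≡⟨ cancel (eval g (+ m)) ⟩
    0ℤ                                       ∎
    where
    cancel : ∀ i → i ℤ.+ -1ℤ ℤ.* i ≡ 0ℤ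
    cancel = solve-∀

repunit : ℕ → Poly
repunit n = replicate n 1ℤ

-- 1 + xⁿ + … + xⁿ⁽ᵏ⁻¹⁾, the quotient of [k n] by [n]
spacedRepunit : ℕ → ℕ → Poly
spacedRepunit n zero    = []
spacedRepunit n (suc k) = [ 1ℤ ] +ᴾ (X^ n) *ᴾ spacedRepunit n k

eval-repunit-+ : ∀ m n x →
  eval (repunit (m ℕ.+ n)) x ≡ eval (repunit m) x ℤ.+ eval (X^ m) x ℤ.* eval (repunit n) x
eval-repunit-+ zero n x = lem x (eval (repunit n) x)
  where
  lem : ∀ x r → r ≡ 0ℤ ℤ.+ (1ℤ ℤ.+ x ℤ.* 0ℤ) ℤ.* r
  lem = solve-∀
eval-repunit-+ (suc m) n x = trans (cong (λ v → 1ℤ ℤ.+ x ℤ.* v) (eval-repunit-+ m n x))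
  (lem x (eval (repunit m) x) (eval (X^ m) x) (eval (repunit n) x))
  where
  lem : ∀ x u v w → 1ℤ ℤ.+ x ℤ.* (u ℤ.+ v ℤ.* w) ≡ (1ℤ ℤ.+ x ℤ.* u) ℤ.+ (0ℤ ℤ.+ x ℤ.* v) ℤ.* w
  lem = solve-∀

eval-repunit-* : ∀ k n x →
  eval (repunit (k * n)) x ≡ eval (repunit n) x ℤ.* eval (spacedRepunit n k) x
eval-repunit-* zero    n x = sym (ℤₚ.*-zeroʳ (eval (repunit n) x))
eval-repunit-* (suc k) n x = begin
  eval (repunit (n ℕ.+ k * n)) x        ≡⟨ eval-repunit-+ n (k * n) x ⟩
  r ℤ.+ t ℤ.* eval (repunit (k * n)) x  ≡⟨ cong (λ v → r ℤ.+ t ℤ.* v) (eval-repunit-* k n x) ⟩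
  r ℤ.+ t ℤ.* (r ℤ.* s)                 ≡⟨ lem x r s t ⟩
  r ℤ.* ((1ℤ ℤ.+ x ℤ.* 0ℤ) ℤ.+ t ℤ.* s) ≡⟨ cong (λ v → r ℤ.* (eval [ 1ℤ ] x ℤ.+ v)) (eval-* (X^ n) (spacedRepunit n k) x) ⟨
  r ℤ.* (eval [ 1ℤ ] x ℤ.+ eval ((X^ n) *ᴾ spacedRepunit n k) x)
                                        ≡⟨ cong (r ℤ.*_) (eval-+ [ 1ℤ ] ((X^ n) *ᴾ spacedRepunit n k) x) ⟨
  r ℤ.* eval (spacedRepunit n (suc k)) x ∎
  where
  open ≡-Reasoning
  r = eval (repunit n) x
  s = eval (spacedRepunit n k) x
  t = eval (X^ n) x

  lem : ∀ x r s t → r ℤ.+ t ℤ.* (r ℤ.* s) ≡ r ℤ.* ((1ℤ ℤ.+ x ℤ.* 0ℤ) ℤ.+ t ℤ.* s)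
  lem = solve-∀

-- Induction from x^(n+1) - 1 = (x - 1) + x (x^n - 1): the recursion of the geometric sum
-- `1 + x * r`, scaled by x - 1.
eval-xⁿ-1 : ∀ n x → eval (xⁿ-1 n) x ≡ (x ℤ.- 1ℤ) ℤ.* eval (repunit n) x
eval-xⁿ-1 n x = trans (eval-+ (X^ n) [ -1ℤ ] x) (go n)
  where
  base : ∀ x → (1ℤ ℤ.+ x ℤ.* 0ℤ) ℤ.+ (-1ℤ ℤ.+ x ℤ.* 0ℤ) ≡ (x ℤ.- 1ℤ) ℤ.* 0ℤ
  base = solve-∀

  shift : ∀ x t → (0ℤ ℤ.+ x ℤ.* t) ℤ.+ (-1ℤ ℤ.+ x ℤ.* 0ℤ) ≡
    (x ℤ.- 1ℤ) ℤ.+ x ℤ.* (t ℤ.+ (-1ℤ ℤ.+ x ℤ.* 0ℤ))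
  shift = solve-∀

  step : ∀ x r → (x ℤ.- 1ℤ) ℤ.+ x ℤ.* ((x ℤ.- 1ℤ) ℤ.* r) ≡ (x ℤ.- 1ℤ) ℤ.* (1ℤ ℤ.+ x ℤ.* r)
  step = solve-∀

  go : ∀ n → eval (X^ n) x ℤ.+ eval [ -1ℤ ] x ≡ (x ℤ.- 1ℤ) ℤ.* eval (repunit n) x
  go zero    = base x
  go (suc n) = trans (shift x (eval (X^ n) x))
    (trans (cong (λ v → (x ℤ.- 1ℤ) ℤ.+ x ℤ.* v) (go n)) (step x (eval (repunit n) x)))

-- The ideal generated by `f` and `g` is all of ℤ[x]. This is stronger than having no common factor,
-- as 2 and x show.
Comaximal : Poly → Poly → Set
Comaximal f g = ∃₂ λ u v → ∀ x → eval u x ℤ.* eval f x ℤ.+ eval v x ℤ.* eval g x ≡ 1ℤ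

comaximal-sym : ∀ f g → Comaximal f g → Comaximal g f
comaximal-sym f g (u , v , e) = v , u , λ x → trans (ℤₚ.+-comm (eval v x ℤ.* _) _) (e x)

-- Factor both sides of [k m] = 1 + x [l n] through [m] and [n]. The quotient of [k m] by [m], and
-- -x times the quotient of [l n] by [n], are the two multipliers.
bézout⇒comaximal : ∀ {m n} k l → 1 ℕ.+ l * n ≡ k * m → Comaximal (repunit m) (repunit n)
bézout⇒comaximal {m} {n} k l eq = spacedRepunit m k , -x *ᴾ spacedRepunit n l , λ x →
  let r = eval (repunit m) x
      s = eval (repunit n) x
      u = eval (spacedRepunit m k) x
      v = eval (spacedRepunit n l) x
      ru≡1+xsv : r ℤ.* u ≡ 1ℤ ℤ.+ x ℤ.* (s ℤ.* v)
      ru≡1+xsv = trans (sym (eval-repunit-* k m x))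
        (trans (cong (λ i → eval (repunit i) x) (sym eq))
          -- `repunit (1 + l * n)` unfolds to `1ℤ ∷ repunit (l * n)`, so its value is already of the
          -- form `1 + x * _`.
          (cong (λ i → 1ℤ ℤ.+ x ℤ.* i) (eval-repunit-* l n x)))
  in begin
    u ℤ.* r ℤ.+ eval (-x *ᴾ spacedRepunit n l) x ℤ.* s
      ≡⟨ cong₂ (λ i j → i ℤ.+ j ℤ.* s) (trans (ℤₚ.*-comm u r) ru≡1+xsv) (eval-* -x (spacedRepunit n l) x) ⟩
    (1ℤ ℤ.+ x ℤ.* (s ℤ.* v)) ℤ.+ (0ℤ ℤ.+ x ℤ.* (-1ℤ ℤ.+ x ℤ.* 0ℤ)) ℤ.* v ℤ.* s
      ≡⟨ lem x s v ⟩
    1ℤ ∎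
  where
  open ≡-Reasoning
  -x = 0ℤ ∷ -1ℤ ∷ []

  lem : ∀ x s v → (1ℤ ℤ.+ x ℤ.* (s ℤ.* v)) ℤ.+ (0ℤ ℤ.+ x ℤ.* (-1ℤ ℤ.+ x ℤ.* 0ℤ)) ℤ.* v ℤ.* s ≡ 1ℤ
  lem = solve-∀

coprime⇒comaximal : ∀ {m n} → Coprime m n → Comaximal (repunit m) (repunit n)
coprime⇒comaximal {m} {n} c with coprime-Bézout c
... | Bézout.+- k l eq = bézout⇒comaximal k l eq
... | Bézout.-+ k l eq = comaximal-sym (repunit n) (repunit m) (bézout⇒comaximal l k eq)

repunit*repunit∣xⁿ-1 : ∀ m n → Coprime m n → repunit m *ᴾ repunit n ∣ᴾ xⁿ-1 (m * n)
repunit*repunit∣xⁿ-1 m n c with u , v , uv ← coprime⇒comaximal c =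
  g , eval-injective (repunit m *ᴾ repunit n *ᴾ g) (xⁿ-1 (m * n)) λ i → values (+ i)
  where
  M = spacedRepunit m n
  N = spacedRepunit n m
  -- The cofactor of [m] [n] in [m n]: multiply u [m] + v [n] = 1 by [m n], written as [n] N in the
  -- first term and as [m] M in the second. Both terms then contain [m] [n].
  w = u *ᴾ N +ᴾ v *ᴾ M
  g = (-1ℤ ∷ 1ℤ ∷ []) *ᴾ w

  values : ∀ x → eval (repunit m *ᴾ repunit n *ᴾ g) x ≡ eval (xⁿ-1 (m * n)) x
  values x = begin
    eval (repunit m *ᴾ repunit n *ᴾ g) x
      ≡⟨ eval-* (repunit m *ᴾ repunit n) g x ⟩
    eval (repunit m *ᴾ repunit n) x ℤ.* eval g x
      ≡⟨ cong₂ ℤ._*_ (eval-* (repunit m) (repunit n) x)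
           (trans (eval-* (-1ℤ ∷ 1ℤ ∷ []) w x) (cong (eval (-1ℤ ∷ 1ℤ ∷ []) x ℤ.*_)
             (trans (eval-+ (u *ᴾ N) (v *ᴾ M) x) (cong₂ ℤ._+_ (eval-* u N x) (eval-* v M x))))) ⟩
    r ℤ.* s ℤ.* ((-1ℤ ℤ.+ x ℤ.* (1ℤ ℤ.+ x ℤ.* 0ℤ)) ℤ.* (u′ ℤ.* N′ ℤ.+ v′ ℤ.* M′))
      ≡⟨ expand x r s u′ v′ M′ N′ ⟩
    (x ℤ.- 1ℤ) ℤ.* (u′ ℤ.* r ℤ.* (s ℤ.* N′) ℤ.+ v′ ℤ.* s ℤ.* (r ℤ.* M′))
      ≡⟨ cong₂ (λ i j → (x ℤ.- 1ℤ) ℤ.* (u′ ℤ.* r ℤ.* i ℤ.+ v′ ℤ.* s ℤ.* j))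
           (sym (eval-repunit-* m n x))
           (trans (sym (eval-repunit-* n m x)) (cong (λ i → eval (repunit i) x) (ℕₚ.*-comm n m))) ⟩
    (x ℤ.- 1ℤ) ℤ.* (u′ ℤ.* r ℤ.* t ℤ.+ v′ ℤ.* s ℤ.* t)
      ≡⟨ cong ((x ℤ.- 1ℤ) ℤ.*_) (ℤₚ.*-distribʳ-+ t (u′ ℤ.* r) (v′ ℤ.* s)) ⟨
    (x ℤ.- 1ℤ) ℤ.* ((u′ ℤ.* r ℤ.+ v′ ℤ.* s) ℤ.* t)
      ≡⟨ cong (λ i → (x ℤ.- 1ℤ) ℤ.* (i ℤ.* t)) (uv x) ⟩
    (x ℤ.- 1ℤ) ℤ.* (1ℤ ℤ.* t)
      ≡⟨ cong ((x ℤ.- 1ℤ) ℤ.*_) (ℤₚ.*-identityˡ t) ⟩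
    (x ℤ.- 1ℤ) ℤ.* t
      ≡⟨ eval-xⁿ-1 (m * n) x ⟨
    eval (xⁿ-1 (m * n)) x ∎
    where
    open ≡-Reasoning
    r = eval (repunit m) x
    s = eval (repunit n) x
    t = eval (repunit (m * n)) x
    u′ = eval u x
    v′ = eval v x
    M′ = eval M x
    N′ = eval N x

    expand : ∀ x r s u v M N →
      r ℤ.* s ℤ.* ((-1ℤ ℤ.+ x ℤ.* (1ℤ ℤ.+ x ℤ.* 0ℤ)) ℤ.* (u ℤ.* N ℤ.+ v ℤ.* M)) ≡
      (x ℤ.- 1ℤ) ℤ.* (u ℤ.* r ℤ.* (s ℤ.* N) ℤ.+ v ℤ.* s ℤ.* (r ℤ.* M))
    expand = solve-∀

coeff-repunit : ∀ n k → k < n → coeff (repunit n) k ≡ 1ℤ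
coeff-repunit (suc n) zero    _         = refl
coeff-repunit (suc n) (suc k) (s≤s k<n) = coeff-repunit n k k<n

-- The coefficient counts the pairs i + j = k with i < m and j < n, and below both lengths no pair
-- is cut off. In the induction the leading 1 of the first factor contributes the pair with i = 0.
coeff-repunit*repunit : ∀ m n k → k < m → k < n →
  coeff (repunit m *ᴾ repunit n) k ≡ + suc k
coeff-repunit*repunit (suc m) n zero _ 0<n =
  trans (coeff-*-zero 1ℤ (repunit m) (repunit n)) (cong (1ℤ ℤ.*_) (coeff-repunit n 0 0<n))
coeff-repunit*repunit (suc m) n (suc k) (s≤s k<m) k+1<n =
  trans (coeff-*-suc 1ℤ (repunit m) (repunit n) k)
    (cong₂ (λ i j → 1ℤ ℤ.* i ℤ.+ j) (coeff-repunit n (suc k) k+1<n)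
      (coeff-repunit*repunit m n k k<m (ℕₚ.<-trans (ℕₚ.n<1+n k) k+1<n)))

⊓≤H-repunit*repunit : ∀ m n → m ⊓ n ≤ H (repunit m *ᴾ repunit n)
⊓≤H-repunit*repunit zero    n       = z≤n
⊓≤H-repunit*repunit (suc m) zero    = z≤n
⊓≤H-repunit*repunit (suc m) (suc n) =
  subst (λ c → ∣ c ∣ ≤ H f)
    -- With both lengths successors, `m ⊓ n` is their minimum less one, and the coefficient
    -- `suc (m ⊓ n)` is the minimum itself by computation.
    (coeff-repunit*repunit (suc m) (suc n) (m ⊓ n) (s≤s (ℕₚ.m⊓n≤m m n)) (s≤s (ℕₚ.m⊓n≤n m n)))
    (H-≥ f (m ⊓ n))
  where f = repunit (suc m) *ᴾ repunit (suc n)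

⊓≤B : ∀ m n .{{_ : NonZero (m * n)}} → Coprime m n → m ⊓ n ≤ B (m * n)
⊓≤B m n c = ℕₚ.≤-trans (⊓≤H-repunit*repunit m n)
  (IsMaxHeight.bounded (B-isMaxHeight (m * n)) (repunit m *ᴾ repunit n)
    (repunit*repunit∣xⁿ-1 m n c))

-- A common divisor of `m` and `n * o` is coprime to `n`, since it divides `m`. By Euclid's lemma it
-- divides `o`.
coprime-*ʳ : ∀ {m n o} → Coprime m n → Coprime m o → Coprime m (n * o)
coprime-*ʳ m⊥n m⊥o (d∣m , d∣n*o) =
  m⊥o (d∣m , coprime-divisor (λ (e∣d , e∣n) → m⊥n (∣-trans e∣d d∣m , e∣n)) d∣n*o)

coprime-^ʳ : ∀ {m n} k → Coprime m n → Coprime m (n ^ k)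
coprime-^ʳ {m} zero    m⊥n = Coprimality.sym (1-coprimeTo m)
coprime-^ʳ     (suc k) m⊥n = coprime-*ʳ m⊥n (coprime-^ʳ k m⊥n)

distinct-primes-coprime : ∀ {p q} → Prime p → Prime q → p ≢ q → Coprime p q
distinct-primes-coprime pp qp p≢q (d∣p , d∣q)
  with prime⇒irreducible pp d∣p | prime⇒irreducible qp d∣q
... | inj₁ d≡1 | _        = d≡1
... | inj₂ _   | inj₁ d≡1 = d≡1
... | inj₂ d≡p | inj₂ d≡q = contradiction (trans (sym d≡p) d≡q) p≢q

mainTheorem2 : (p q : ℕ) (p-prime : Prime p) (q-prime : Prime q) → p ≢ q →
    (a b : ℕ) → 0 < a → 0 < b →
    p ^ a ⊓ q ^ b ≤ B (p ^ a * q ^ b) {{p^a*q^b≢0 p-prime q-prime a b}}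
mainTheorem2 p q p-prime q-prime p≢q a b _ _ =
  ⊓≤B (p ^ a) (q ^ b) {{p^a*q^b≢0 p-prime q-prime a b}}
    -- `coprime-^ʳ` raises only the right argument, so the pair is swapped to reach p^a and swapped
    -- back for q^b.
    (coprime-^ʳ b (Coprimality.sym (coprime-^ʳ a
      (Coprimality.sym (distinct-primes-coprime p-prime q-prime p≢q)))))
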